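{- Let $q$ be a prime power and $r\ge 2$ an integer. Let $\gamma\in\mathbb{F}_{q^r}$ be a primitive element and let $M\in\mathbb{F}_q^{r\times r}$ be the companion matrix of the minimal polynomial of $\gamma$ over $\mathbb{F}_q$. In $\mathrm{PG}(2r-1,q)$ define $V_0=\{[x:0] : x\in\mathrm{PG}(r-1,q)\}$, $V_{q^r}=\{[0:y] : y\in\mathrm{PG}(r-1,q)\}$, and $V_i=\{[x:xM^i] : x\in\mathrm{PG}(r-1,q)\}$ for $1\le i\le q^r-1$. Let $i,j$ be integers with $0<i<j<q^r$ and suppose that for every $s>1$ dividing $r$ we have $j-i\not\equiv 0 \bmod \frac{q^s-1}{q-1}$. Then $\mathcal{B}=V_0\cup V_i\cup V_j\cup V_{q^r}$ is a cutting blocking set in $\mathrm{PG}(2r-1,q)$.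
   Context: $\mathrm{PG}(N,q)$ is the projective space $(\mathbb{F}_q^{N+1}\setminus\{0\})/\!\sim$ over $\mathbb{F}_q$, where $\sim$ is proportionality; vectors are row vectors. A primitive element of $\mathbb{F}_{q^r}$ is a generator of its multiplicative group. A set $\mathcal{M}\subseteq\mathrm{PG}(N,q)$ ($N\ge1$) is a cutting blocking set if for every hyperplane $H$ of $\mathrm{PG}(N,q)$ one has $\langle \mathcal{M}\cap H\rangle=H$, where $\langle\cdot\rangle$ denotes the projective span. (The family $\{V_0,\dots,V_{q^r}\}$ is an $(r-1)$-spread of $\mathrm{PG}(2r-1,q)$, i.e. a partition of its points into $(r-1)$-dimensional subspaces.) -}

module Defs where

open import Algebra.Bundles using (CommutativeRing; Semiring)
import Algebra.Definitions.RawSemiring as RawSemiringDefs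
open import Data.Bool.Base using (if_then_else_)
open import Data.Fin.Base using (Fin; toℕ)
open import Data.Nat.Base as ℕ using (ℕ; zero; suc; pred; NonZero; _∸_)
open import Data.Nat.DivMod using (_/_)
import Data.Nat.Properties as ℕₚ
open import Data.Nat.Primality using (Prime; prime⇒nonTrivial)
open import Data.Product.Base using (Σ; ∃; _×_; _,_)
open import Data.Vec.Functional using (Vector; _++_)
import Data.Vec.Functional.Relation.Binary.Equality.Setoid as VecEq
open import Function.Bundles using (Inverse)
open import Level using (Level; _⊔_) renaming (suc to lsuc)
open import Relation.Binary.PropositionalEquality as ≡ using (_≡_)
open import Relation.Nullary.Decidable using (does)
open import Relation.Nullary.Negation using (¬_)
open import Relation.Unary using (Pred; _∩_; _≐_)

private
  variable
    c ℓ c′ ℓ′ s : Level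
    m n r : ℕ

record IsPrimePower (q : ℕ) : Set where
  field
    p k     : ℕ
    prime   : Prime p
    k≥1     : 1 ℕ.≤ k
    q≡p^k   : q ≡ p ℕ.^ k

primePower⇒nonZero : ∀ {q} → IsPrimePower q → NonZero (q ∸ 1)
primePower⇒nonZero {q} pp = ℕ.>-nonZero (ℕₚ.m<n⇒0<n∸m 1<q)
  where
  open IsPrimePower pp
  1<p : 1 ℕ.< p
  1<p = ℕ.nonTrivial⇒n>1 p {{prime⇒nonTrivial prime}}
  1<q : 1 ℕ.< q
  1<q = begin-strict
    1        <⟨ 1<p ⟩
    p        ≡⟨ ℕₚ.^-identityʳ p ⟨
    p ℕ.^ 1  ≤⟨ ℕₚ.^-monoʳ-≤ p {{ℕ.>-nonZero (ℕₚ.<⇒≤ 1<p)}} k≥1 ⟩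
    p ℕ.^ k  ≡⟨ q≡p^k ⟨
    q        ∎
    where open ℕₚ.≤-Reasoning

repunit : (q : ℕ) → IsPrimePower q → ℕ → ℕ
repunit q pp s = _/_ (q ℕ.^ s ∸ 1) (q ∸ 1) {{primePower⇒nonZero pp}}

record IsFiniteField (F : CommutativeRing c ℓ) (q : ℕ) : Set (c ⊔ ℓ) where
  open CommutativeRing F
  field
    1≉0         : ¬ (1# ≈ 0#)
    inverse     : ∀ x → ¬ (x ≈ 0#) → ∃ λ y → x * y ≈ 1#
    cardinality : Inverse setoid (≡.setoid (Fin q))

-- The multiplicative group consists of the nonzero elements; being finite, it
-- is generated by γ iff every element is a natural-number power of γ.
record IsPrimitive (L : CommutativeRing c ℓ)
                   (γ : CommutativeRing.Carrier L) : Set (c ⊔ ℓ) where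
  open CommutativeRing L
  open RawSemiringDefs (Semiring.rawSemiring semiring) using (_^_)
  field
    nonzero    : ¬ (γ ≈ 0#)
    generates  : ∀ x → ¬ (x ≈ 0#) → ∃ λ k → x ≈ γ ^ k

module _ (F : CommutativeRing c ℓ) (L : CommutativeRing c′ ℓ′) where
  private
    module F = CommutativeRing F
    module L = CommutativeRing L
  open RawSemiringDefs (Semiring.rawSemiring L.semiring) using (_^_; sum)

  -- a : Vector F.Carrier n stands for the monic polynomial
  -- Xⁿ + aₙ₋₁ Xⁿ⁻¹ + ⋯ + a₁ X + a₀ of degree n.
  evalMonic : (F.Carrier → L.Carrier) → Vector F.Carrier n → L.Carrier → L.Carrier
  evalMonic {n = n} ι a γ = γ ^ n L.+ sum (λ k → ι (a k) L.* γ ^ toℕ k)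

  record IsMinimalPolynomial (ι : F.Carrier → L.Carrier) (γ : L.Carrier)
                             (a : Vector F.Carrier n) : Set (c ⊔ ℓ′) where
    field
      root    : evalMonic ι a γ L.≈ L.0#
      minimal : ∀ d → d ℕ.< n → (b : Vector F.Carrier d) →
                ¬ (evalMonic ι b γ L.≈ L.0#)

module _ (F : CommutativeRing c ℓ) where
  open CommutativeRing F
  open RawSemiringDefs (Semiring.rawSemiring semiring) using (sum)
  open VecEq setoid using (_≋_)

  Matrix : ℕ → ℕ → Set c
  Matrix m n = Fin m → Fin n → Carrier

  identity : ∀ n → Matrix n n
  identity n i k = if does (toℕ i ℕₚ.≟ toℕ k) then 1# else 0#

  matMul : ∀ {l} → Matrix l m → Matrix m n → Matrix l n
  matMul A B i k = sum (λ j → A i j * B j k)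

  matPow : Matrix n n → ℕ → Matrix n n
  matPow M zero    = identity _
  matPow M (suc e) = matMul M (matPow M e)

  vecMul : Vector Carrier m → Matrix m n → Vector Carrier n
  vecMul x A k = sum (λ i → x i * A i k)

  -- Row-vector convention: 1s on the superdiagonal and last row
  -- (-a₀, …, -aₙ₋₁), so that x ↦ xM is multiplication by the root γ in the
  -- basis 1, γ, …, γⁿ⁻¹.
  companion : Vector Carrier n → Matrix n n
  companion {n = n} a i k =
    if does (suc (toℕ i) ℕₚ.≟ n) then - a k
    else if does (toℕ k ℕₚ.≟ suc (toℕ i)) then 1#
    else 0#

  0ⱽ : Vector Carrier n
  0ⱽ _ = 0#

  lincomb : Vector Carrier m → Vector (Vector Carrier n) m → Vector Carrier n
  lincomb a b i = sum (λ k → a k * b k i)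

  LinearlyIndependent : Vector (Vector Carrier n) m → Set (c ⊔ ℓ)
  LinearlyIndependent b = ∀ a → lincomb a b ≋ 0ⱽ → ∀ k → a k ≈ 0#

  InLinearSpan : Vector Carrier n → Vector (Vector Carrier n) m → Set (c ⊔ ℓ)
  InLinearSpan v b = ∃ λ a → v ≋ lincomb a b

  _∼_ : Vector Carrier n → Vector Carrier n → Set (c ⊔ ℓ)
  v ∼ w = ∃ λ a → ¬ (a ≈ 0#) × v ≋ (λ i → a * w i)

  -- Point n represents the points of PG(n - 1, q): the index is the dimension
  -- of the underlying vector space.  A point is given by a representative
  -- vector, and two points are equal when their representatives are related
  -- by _∼_; the predicates below only depend on P up to this relation.
  record Point (n : ℕ) : Set (c ⊔ ℓ) where
    field
      vec     : Vector Carrier n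
      nonzero : ¬ (vec ≋ 0ⱽ)
  open Point

  ProjectiveSpan : Pred (Point n) s → Pred (Point n) (c ⊔ ℓ ⊔ s)
  ProjectiveSpan {n = n} S P =
    ∃ λ m → Σ (Vector (Point n) m) λ Q →
      (∀ k → S (Q k)) × InLinearSpan (vec P) (λ k → vec (Q k))

  -- The points of an (n - 1)-dimensional linear subspace.
  IsHyperplane : Pred (Point n) (c ⊔ ℓ) → Set (c ⊔ ℓ)
  IsHyperplane {n = n} H =
    Σ (Vector (Vector Carrier n) (pred n)) λ b →
      LinearlyIndependent b × H ≐ (λ P → InLinearSpan (vec P) b)

  IsCuttingBlockingSet : Pred (Point n) s → Set (lsuc (c ⊔ ℓ) ⊔ s)
  IsCuttingBlockingSet {n = n} M =
    (H : Pred (Point n) (c ⊔ ℓ)) → IsHyperplane H → ProjectiveSpan (M ∩ H) ≐ H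

  V₀ : ∀ r → Pred (Point (r ℕ.+ r)) (c ⊔ ℓ)
  V₀ r P = Σ (Point r) λ x → vec P ∼ (vec x ++ 0ⱽ {n = r})

  -- V_{q^r}
  V∞ : ∀ r → Pred (Point (r ℕ.+ r)) (c ⊔ ℓ)
  V∞ r P = Σ (Point r) λ y → vec P ∼ (0ⱽ {n = r} ++ vec y)

  V : Matrix r r → ℕ → Pred (Point (r ℕ.+ r)) (c ⊔ ℓ)
  V {r = r} M i P = Σ (Point r) λ x → vec P ∼ (vec x ++ vecMul (vec x) (matPow M i))

{-# OPTIONS --safe #-}

-- A hyperplane is the kernel of a functional h = (f , g) on F^r × F^r.  Given
-- (x , y) in it with f(x) = α and g(y) = -α, any z with f(z) = α and
-- g(zMᵉ) = -α, e ∈ {i , j}, yields the decomposition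
--   (x , y) = (x - z , 0) + (0 , y - zMᵉ) + (z , zMᵉ)
-- into vectors of H over V₀, V∞ and Vₑ.  If no such z exists for either
-- exponent, then g(zMⁱ) = a f(z) and g(zMʲ) = b f(z) for all z.  Identifying
-- F^r with L, so that M becomes multiplication by γ, this forces
-- ι(a) γʲ = ι(b) γⁱ with a, b ≠ 0.  By Fermat's little theorem in F,
-- γ^((j-i)(q-1)) = 1, so q^r - 1 divides (j-i)(q-1), which is excluded by the
-- hypothesis at s = r.
module Submission where

open import Defs
open import Level using (Level)
open import Algebra.Bundles using (CommutativeRing)
open import Algebra.Morphism.Structures using (IsRingHomomorphism)
import Algebra.Properties.CommutativeMonoid.Sum as MonoidSum
import Algebra.Properties.CommutativeSemigroup as Semigroupₚ
import Algebra.Properties.CommutativeSemiring.Exp as Exp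
import Algebra.Properties.Ring as Ringₚ
import Algebra.Properties.Semiring.Sum as SemiringSum
open import Data.Bool.Base using (true; false)
open import Data.Fin.Base as Fin using (Fin; zero; suc; toℕ; fromℕ; fromℕ<; inject₁; punchIn;
  splitAt; combine; funToFin; finToFun)
import Data.Fin.Permutation as Perm
import Data.Fin.Properties as Finₚ
open import Data.Fin.Relation.Unary.Top using (view; ‵fromℕ; ‵inject₁)
open import Data.Nat.Base as ℕ using (ℕ; zero; suc; _≤_; _<_; _∸_; _^_)
open import Data.Nat.Divisibility using (_∣_; ∣-refl; ∣m∣n⇒∣m+n; ∣n⇒∣m*n; m%n≡0⇒n∣m; *-cancelʳ-∣; _∣0)
open import Data.Nat.DivMod using (_/_; _%_; m≡m%n+[m/n]*n; m%n<n; m/n*n≡m)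
import Data.Nat.Properties as ℕₚ
open import Data.Product.Base using (Σ; ∃; _×_; _,_; proj₁; proj₂)
open import Data.Sum.Base using (_⊎_; inj₁; inj₂)
open import Data.Vec.Functional using (Vector; replicate; init; last; _∷_; _++_)
open import Data.Vec.Functional.Properties using (lookup-++ˡ; lookup-++ʳ)
import Data.Vec.Functional.Relation.Binary.Equality.Setoid as VecEq
open import Function.Base using (_∘_)
open import Function.Bundles using (Inverse)
open import Function.Definitions using (Injective)
open import Relation.Binary.PropositionalEquality as ≡ using (_≡_)
import Relation.Binary.Reasoning.Setoid as SetoidReasoning
open import Relation.Nullary.Decidable using (Dec; yes; no; map′; ¬?; decidable-stable; dec-true; dec-false)
open import Relation.Nullary.Negation using (¬_; contradiction)
open import Relation.Unary using (Pred; _∪_; _∩_; _≐_)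

private
  variable
    c ℓ c′ ℓ′ ℓ″ : Level
    k m n r : ℕ

-- Bilinear algebra of the dot product.

module DotProduct (R : CommutativeRing c ℓ) where
  open CommutativeRing R hiding (zero)
  open Ringₚ ring using (-1*x≈-x)
  open SemiringSum semiring
  open Semigroupₚ *-commutativeSemigroup using (x∙yz≈y∙xz)
  open VecEq setoid using (_≋_)
  open SetoidReasoning setoid

  dot : Vector Carrier n → Vector Carrier n → Carrier
  dot h v = sum (λ k → h k * v k)

  dot-cong : {h h′ v v′ : Vector Carrier n} → h ≋ h′ → v ≋ v′ → dot h v ≈ dot h′ v′
  dot-cong h≋h′ v≋v′ = sum-cong-≋ (λ k → *-cong (h≋h′ k) (v≋v′ k))

  dot-congˡ : (h : Vector Carrier n) {v v′ : Vector Carrier n} → v ≋ v′ → dot h v ≈ dot h v′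
  dot-congˡ h = dot-cong (λ _ → refl)

  dot-comm : (h v : Vector Carrier n) → dot h v ≈ dot v h
  dot-comm h v = sum-cong-≋ (λ k → *-comm (h k) (v k))

  dot-scale : ∀ a (h v : Vector Carrier n) → dot h (λ k → a * v k) ≈ a * dot h v
  dot-scale a h v = begin
    sum (λ k → h k * (a * v k))  ≈⟨ sum-cong-≋ (λ k → x∙yz≈y∙xz (h k) a (v k)) ⟩
    sum (λ k → a * (h k * v k))  ≈⟨ *-distribˡ-sum a (λ k → h k * v k) ⟨
    a * dot h v                  ∎

  dot-+ : (h v w : Vector Carrier n) → dot h (λ k → v k + w k) ≈ dot h v + dot h w
  dot-+ h v w = trans (sum-cong-≋ (λ k → distribˡ (h k) (v k) (w k))) (∑-distrib-+ (λ k → h k * v k) (λ k → h k * w k))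

  dot-neg : (h v : Vector Carrier n) → dot h (λ k → - v k) ≈ - dot h v
  dot-neg h v = begin
    dot h (λ k → - v k)       ≈⟨ dot-congˡ h (λ k → sym (-1*x≈-x (v k))) ⟩
    dot h (λ k → - 1# * v k)  ≈⟨ dot-scale (- 1#) h v ⟩
    - 1# * dot h v            ≈⟨ -1*x≈-x _ ⟩
    - dot h v                 ∎

  dot-minus : (h v w : Vector Carrier n) → dot h (λ k → v k - w k) ≈ dot h v - dot h w
  dot-minus h v w = trans (dot-+ h v _) (+-congˡ (dot-neg h w))

  dot-zeroʳ : (h : Vector Carrier n) {v : Vector Carrier n} → v ≋ 0ⱽ R → dot h v ≈ 0#
  dot-zeroʳ {n = n} h v≋0 = trans (sum-cong-≋ (λ k → trans (*-congˡ (v≋0 k)) (zeroʳ (h k))))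
                                  (sum-replicate-zero n)

  -- Exchanging the two summations. Since `vecMul R x A` unfolds to `lincomb R x A`, this is also
  -- the transpose identity: h(xA) pairs x with the values of h on the rows of A.
  dot-lincomb : (h : Vector Carrier n) (a : Vector Carrier m) (b : Vector (Vector Carrier n) m) →
                dot h (lincomb R a b) ≈ dot a (λ k → dot h (b k))
  dot-lincomb h a b = begin
    sum (λ i → h i * sum (λ k → a k * b k i))    ≈⟨ sum-cong-≋ (λ i → *-distribˡ-sum (h i) (λ k → a k * b k i)) ⟩
    sum (λ i → sum (λ k → h i * (a k * b k i)))  ≈⟨ ∑-comm (λ i k → h i * (a k * b k i)) ⟩
    sum (λ k → sum (λ i → h i * (a k * b k i)))  ≈⟨ sum-cong-≋ (λ k → dot-scale (a k) h (b k)) ⟩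
    sum (λ k → a k * dot h (b k))                ∎

  dot-identity : (v : Vector Carrier n) (k : Fin n) → dot v (λ i → identity R n i k) ≈ v k
  dot-identity {suc n} v zero = begin
    v zero * 1# + sum (λ i → v (suc i) * 0#)  ≈⟨ +-cong (*-identityʳ _) (dot-zeroʳ (v ∘ suc) (λ _ → refl)) ⟩
    v zero + 0#                               ≈⟨ +-identityʳ _ ⟩
    v zero                                    ∎
  dot-identity {suc n} v (suc k) = begin
    v zero * 0# + dot (v ∘ suc) (λ i → identity R n i k)  ≈⟨ +-cong (zeroʳ _) (dot-identity (v ∘ suc) k) ⟩
    0# + v (suc k)                                        ≈⟨ +-identityˡ _ ⟩
    v (suc k)                                             ∎

  dot-scaleˡ : ∀ a (v h : Vector Carrier n) → dot (λ k → a * v k) h ≈ a * dot v h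
  dot-scaleˡ a v h = trans (dot-comm _ h) (trans (dot-scale a h v) (*-congˡ (dot-comm h v)))

  dot-negˡ : (v h : Vector Carrier n) → dot (λ k → - v k) h ≈ - dot v h
  dot-negˡ v h = trans (dot-comm _ h) (trans (dot-neg h v) (-‿cong (dot-comm h v)))

  dot-minusˡ : (v w h : Vector Carrier n) → dot (λ k → v k - w k) h ≈ dot v h - dot w h
  dot-minusˡ v w h = trans (dot-comm _ h) (trans (dot-minus h v w)
    (+-cong (dot-comm h v) (-‿cong (dot-comm h w))))

  dot-zeroˡ : {v : Vector Carrier n} (h : Vector Carrier n) → v ≋ 0ⱽ R → dot v h ≈ 0#
  dot-zeroˡ {v = v} h v≋0 = trans (dot-comm v h) (dot-zeroʳ h v≋0)

  dot-lincombˡ : (a : Vector Carrier m) (b : Vector (Vector Carrier n) m) (h : Vector Carrier n) →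
                 dot (lincomb R a b) h ≈ dot a (λ k → dot (b k) h)
  dot-lincombˡ a b h = trans (dot-comm _ h) (trans (dot-lincomb h a b) (dot-congˡ a (λ k → dot-comm h (b k))))

  dot-identityˡ : (v : Vector Carrier n) (k : Fin n) → dot (λ i → identity R n i k) v ≈ v k
  dot-identityˡ v k = trans (dot-comm _ v) (dot-identity v k)

  dot-++ : (h v : Vector Carrier (m ℕ.+ n)) →
           dot h v ≈ dot (h ∘ (Fin._↑ˡ n)) (v ∘ (Fin._↑ˡ n)) + dot (h ∘ (m Fin.↑ʳ_)) (v ∘ (m Fin.↑ʳ_))
  dot-++ {zero}  h v = sym (+-identityˡ _)
  dot-++ {suc m} h v = trans (+-congˡ (dot-++ {m} (h ∘ suc) (v ∘ suc))) (sym (+-assoc _ _ _))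

  vecMul-identity : (v : Vector Carrier n) → vecMul R v (identity R n) ≋ v
  vecMul-identity = dot-identity

  vecMul-matMul : (v : Vector Carrier k) (A : Matrix R k m) (B : Matrix R m n) →
                  vecMul R v (matMul R A B) ≋ vecMul R (vecMul R v A) B
  vecMul-matMul v A B i = sym (dot-lincombˡ v A (λ l → B l i))

-- Finite fields, and linear algebra over them by counting.

-- Functions are compared only pointwise, so congruence of this encoding takes an induction over the
-- digits.
funToFin-cong : {f g : Fin m → Fin n} → (∀ i → f i ≡ g i) → funToFin f ≡ funToFin g
funToFin-cong {zero}  f≗g = ≡.refl
funToFin-cong {suc m} f≗g = ≡.cong₂ combine (f≗g zero) (funToFin-cong (f≗g ∘ suc))

module Field (F : CommutativeRing c ℓ) {q : ℕ} (F-field : IsFiniteField F q) where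
  open CommutativeRing F hiding (zero)
  open Ringₚ ring using (x∙y⁻¹≈ε⇒x≈y)
  open Exp commutativeSemiring using () renaming (_^_ to _^′_)
  open IsFiniteField F-field public
  open Inverse cardinality using (to; from; to-cong; strictlyInverseˡ; strictlyInverseʳ)
  open DotProduct F
  open VecEq setoid using (_≋_)
  open SetoidReasoning setoid

  to-injective : ∀ {x y} → to x ≡ to y → x ≈ y
  to-injective {x} {y} eq = trans (sym (strictlyInverseʳ x)) (trans (reflexive (≡.cong from eq)) (strictlyInverseʳ y))

  infix 4 _≟_
  -- Decided on the indices in `Fin q`. The later case splits on whether scalars or vectors vanish
  -- rest on this.
  _≟_ : ∀ x y → Dec (x ≈ y)
  x ≟ y = map′ to-injective to-cong (to x Finₚ.≟ to y)

  -- The distinct elements 0 and 1 embed `Fin 2` into `Fin q`. Strictness is what makes q^m < q^n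
  -- for m < n in the pigeonhole count.
  1<q : 1 < q
  1<q = Finₚ.injective⇒≤ {f = f} f-injective
    where
    f : Fin 2 → Fin q
    f zero    = to 0#
    f (suc _) = to 1#
    f-injective : Injective _≡_ _≡_ f
    f-injective {zero}     {zero}     _  = ≡.refl
    f-injective {zero}     {suc zero} eq = contradiction (sym (to-injective eq)) 1≉0
    f-injective {suc zero} {zero}     eq = contradiction (to-injective eq) 1≉0
    f-injective {suc zero} {suc zero} _  = ≡.refl

  *-cancelˡ : ∀ {x y z} → ¬ (x ≈ 0#) → x * y ≈ x * z → y ≈ z
  *-cancelˡ {x} {y} {z} x≉0 eq = let t , xt≈1 = inverse x x≉0
                                     tx≈1 = trans (*-comm t x) xt≈1 in begin
    y            ≈⟨ *-identityˡ y ⟨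
    1# * y       ≈⟨ *-congʳ tx≈1 ⟨
    (t * x) * y  ≈⟨ *-assoc t x y ⟩
    t * (x * y)  ≈⟨ *-congˡ eq ⟩
    t * (x * z)  ≈⟨ *-assoc t x z ⟨
    (t * x) * z  ≈⟨ *-congʳ tx≈1 ⟩
    1# * z       ≈⟨ *-identityˡ z ⟩
    z            ∎

  *-cancelʳ : ∀ {x y z} → ¬ (x ≈ 0#) → y * x ≈ z * x → y ≈ z
  *-cancelʳ x≉0 eq = *-cancelˡ x≉0 (trans (*-comm _ _) (trans eq (*-comm _ _)))

  x*y≈0⇒y≈0 : ∀ {x y} → ¬ (x ≈ 0#) → x * y ≈ 0# → y ≈ 0#
  x*y≈0⇒y≈0 {x} x≉0 eq = *-cancelˡ x≉0 (trans eq (sym (zeroʳ x)))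

  *-nonzero : ∀ {x y} → ¬ (x ≈ 0#) → ¬ (y ≈ 0#) → ¬ (x * y ≈ 0#)
  *-nonzero x≉0 y≉0 xy≈0 = y≉0 (x*y≈0⇒y≈0 x≉0 xy≈0)

  ^-nonzero : ∀ {x} → ¬ (x ≈ 0#) → ∀ n → ¬ (x ^′ n ≈ 0#)
  ^-nonzero x≉0 zero    = 1≉0
  ^-nonzero x≉0 (suc n) = *-nonzero x≉0 (^-nonzero x≉0 n)

  divide : ∀ x y → ¬ (x ≈ 0#) → ∃ λ z → z * x ≈ y
  divide x y x≉0 = let t , xt≈1 = inverse x x≉0 in y * t , (begin
    (y * t) * x  ≈⟨ *-assoc y t x ⟩
    y * (t * x)  ≈⟨ *-congˡ (trans (*-comm t x) xt≈1) ⟩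
    y * 1#       ≈⟨ *-identityʳ y ⟩
    y            ∎)

  ≋0? : (v : Vector Carrier n) → Dec (v ≋ 0ⱽ F)
  ≋0? v = Finₚ.all? (λ k → v k ≟ 0#)

  nonzeroEntry : {v : Vector Carrier n} → ¬ (v ≋ 0ⱽ F) → ∃ λ k → ¬ (v k ≈ 0#)
  nonzeroEntry {v = v} = Finₚ.¬∀⟶∃¬ _ (λ k → v k ≈ 0#) (λ k → v k ≟ 0#)

  -- F^m has q^m elements, so two of the q^n linear combinations of the w k
  -- coincide; their difference is the relation.
  nontrivialRelation : m < n → (w : Vector (Vector Carrier m) n) →
                       ∃ λ a → ¬ (a ≋ 0ⱽ F) × lincomb F a w ≋ 0ⱽ F
  nontrivialRelation {m} {n} m<n w =
    let i , j , i<j , eq = Finₚ.pigeonhole (ℕₚ.^-monoʳ-< q 1<q m<n) encode∘lincomb in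
    (λ k → decode i k - decode j k) , distinct i<j , relation eq
    where
    decode : Fin (q ^ n) → Vector Carrier n
    decode i = from ∘ finToFun i

    encode∘lincomb : Fin (q ^ n) → Fin (q ^ m)
    encode∘lincomb i = funToFin (to ∘ lincomb F (decode i) w)

    -- An index is recovered from its base-`q` digits, so equal coefficient vectors would force
    -- equal indices.
    distinct : ∀ {i j} → i Fin.< j → ¬ ((λ k → decode i k - decode j k) ≋ 0ⱽ F)
    distinct {i} {j} i<j i-j≋0 = Finₚ.<⇒≢ i<j (≡.trans (≡.sym (Finₚ.funToFin-finToFin {n} i))
      (≡.trans (funToFin-cong digits) (Finₚ.funToFin-finToFin {n} j)))
      where
      digits : ∀ k → finToFun i k ≡ finToFun j k
      digits k = ≡.trans (≡.sym (strictlyInverseˡ _))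
        (≡.trans (to-cong (x∙y⁻¹≈ε⇒x≈y _ _ (i-j≋0 k))) (strictlyInverseˡ _))

    relation : ∀ {i j} → encode∘lincomb i ≡ encode∘lincomb j →
               lincomb F (λ k → decode i k - decode j k) w ≋ 0ⱽ F
    relation {i} {j} eq l = begin
      lincomb F (λ k → decode i k - decode j k) w l        ≈⟨ dot-minusˡ (decode i) (decode j) (λ k → w k l) ⟩
      lincomb F (decode i) w l - lincomb F (decode j) w l  ≈⟨ +-congʳ (to-injective same) ⟩
      lincomb F (decode j) w l - lincomb F (decode j) w l  ≈⟨ -‿inverseʳ _ ⟩
      0#                                                   ∎
      where
      same : to (lincomb F (decode i) w l) ≡ to (lincomb F (decode j) w l)
      same = ≡.trans (≡.sym (Finₚ.finToFun-funToFin _ l))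
        (≡.trans (≡.cong (λ x → finToFun x l) eq) (Finₚ.finToFun-funToFin _ l))

  -- With e a unit vector on which h does not vanish, e, v and the b k are
  -- dependent; applying h kills the coefficient of e, and that of v is nonzero
  -- because b is independent.
  hyperplaneFunctional : (b : Vector (Vector Carrier (suc m)) m) → LinearlyIndependent F b →
    ∃ λ h → (∀ k → dot h (b k) ≈ 0#) × (∀ v → dot h v ≈ 0# → InLinearSpan F v b)
  hyperplaneFunctional {m} b b-indep
    -- The `suc m` coordinate columns of `b` lie in F^m; a nontrivial relation among them is, read
    -- row by row, a functional killing every `b k`.
    with h , h≉0 , h-rel ← nontrivialRelation ℕₚ.≤-refl (λ i k → b k i)
    = h , h-rel , spanned
    where
    spanned : ∀ v → dot h v ≈ 0# → InLinearSpan F v b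
    spanned v hv≈0 = go (nonzeroEntry h≉0)
      where
      go : ∃ (λ p → ¬ (h p ≈ 0#)) → InLinearSpan F v b
      go (p , hp≉0) = finish (nontrivialRelation ℕₚ.≤-refl w)
        where
        e : Vector Carrier (suc m)
        e i = identity F (suc m) i p

        w : Vector (Vector Carrier (suc m)) (suc (suc m))
        w zero          = e
        w (suc zero)    = v
        w (suc (suc k)) = b k

        finish : ∃ (λ a → ¬ (a ≋ 0ⱽ F) × lincomb F a w ≋ 0ⱽ F) → InLinearSpan F v b
        finish (a , a≉0 , a-rel) = (λ k → t * (- a (suc (suc k)))) , v-comb
          where
          δ = a zero
          β = a (suc zero)
          a′ : Vector Carrier m
          a′ k = a (suc (suc k))

          δ≈0 : δ ≈ 0#
          δ≈0 = x*y≈0⇒y≈0 hp≉0 (begin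
            h p * δ                        ≈⟨ *-comm _ _ ⟩
            δ * h p                        ≈⟨ *-congˡ (dot-identity h p) ⟨
            δ * dot h e                    ≈⟨ +-identityʳ _ ⟨
            δ * dot h e + 0#               ≈⟨ +-congˡ (+-identityʳ 0#) ⟨
            δ * dot h e + (0# + 0#)        ≈⟨ +-congˡ (+-cong (trans (*-congˡ hv≈0) (zeroʳ β)) (dot-zeroʳ a′ h-rel)) ⟨
            dot a (λ k → dot h (w k))      ≈⟨ dot-lincomb h a w ⟨
            dot h (lincomb F a w)          ≈⟨ dot-zeroʳ h a-rel ⟩
            0#                             ∎)

          βv+ : ∀ i → β * v i + lincomb F a′ b i ≈ 0#
          βv+ i = begin
            β * v i + lincomb F a′ b i              ≈⟨ +-identityˡ _ ⟨
            0# + (β * v i + lincomb F a′ b i)       ≈⟨ +-congʳ (trans (*-congʳ δ≈0) (zeroˡ _)) ⟨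
            δ * e i + (β * v i + lincomb F a′ b i)  ≈⟨ a-rel i ⟩
            0#                                      ∎

          β≉0 : ¬ (β ≈ 0#)
          β≉0 β≈0 = a≉0 λ
            { zero          → δ≈0
            ; (suc zero)    → β≈0
            ; (suc (suc k)) → b-indep a′ (λ i → trans (sym (trans (+-congʳ (trans (*-congʳ β≈0) (zeroˡ _)))
                                                               (+-identityˡ _))) (βv+ i)) k }

          t = proj₁ (inverse β β≉0)

          v-comb : v ≋ lincomb F (λ k → t * (- a′ k)) b
          v-comb i = *-cancelˡ β≉0 (begin
            β * v i                                 ≈⟨ Ringₚ.+-inverseˡ-unique ring _ _ (βv+ i) ⟩
            - lincomb F a′ b i                      ≈⟨ dot-negˡ a′ (λ k → b k i) ⟨
            lincomb F (λ k → - a′ k) b i            ≈⟨ *-identityˡ _ ⟨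
            1# * lincomb F (λ k → - a′ k) b i       ≈⟨ *-congʳ (proj₂ (inverse β β≉0)) ⟨
            (β * t) * lincomb F (λ k → - a′ k) b i  ≈⟨ *-assoc β t _ ⟩
            β * (t * lincomb F (λ k → - a′ k) b i)  ≈⟨ *-congˡ (dot-scaleˡ t (λ k → - a′ k) (λ k → b k i)) ⟨
            β * lincomb F (λ k → t * (- a′ k)) b i  ∎)

  -- Second case: the kernel of f + g lies in that of f, so f + g is a multiple of f.
  separate⊎proportional : (f g : Vector Carrier n) → ¬ (f ≋ 0ⱽ F) →
    (∃ λ z → ¬ (dot f z ≈ 0#) × dot f z + dot g z ≈ 0#) ⊎
    (∃ λ a → ∀ z → dot g z ≈ a * dot f z)
  separate⊎proportional {n} f g f≉0
    with i , fi≉0 ← nonzeroEntry f≉0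
    -- The two sides differ by the 2 × 2 minor of `f` and `f + g` on the columns `i` and `l`. As
    -- `f i` is nonzero, these minors all vanish only if `f + g` is a multiple of `f`.
    with Finₚ.any? (λ l → ¬? (f l * (f i + g i) ≟ f i * (f l + g l)))
  ... | yes (l , p) = inj₁ (z , fz≉0 , (begin
      dot f z + dot g z  ≈⟨ +-cong (dot-z f) (dot-z g) ⟩
      (s * f l - s′ * f i) + (s * g l - s′ * g i)  ≈⟨ interchange _ _ _ _ ⟩
      (s * f l + s * g l) + (- (s′ * f i) + - (s′ * g i))
        ≈⟨ +-cong (sym (distribˡ s (f l) (g l))) (trans (-‿+-comm _ _) (-‿cong (sym (distribˡ s′ (f i) (g i))))) ⟩
      s * s′ - s′ * s  ≈⟨ +-congʳ (*-comm s s′) ⟩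
      s′ * s - s′ * s  ≈⟨ -‿inverseʳ _ ⟩
      0#               ∎))
    where
    open Semigroupₚ +-commutativeSemigroup using (interchange)
    open Ringₚ ring using (-‿+-comm)
    s = f i + g i
    s′ = f l + g l
    -- The standard kernel element of `f + g` supported on `i` and `l`; its value under `f` is the
    -- nonvanishing minor.
    z : Vector Carrier n
    z k = s * identity F n k l - s′ * identity F n k i
    dot-z : ∀ h → dot h z ≈ s * h l - s′ * h i
    dot-z h = trans (dot-minus h _ _) (+-cong
      (trans (dot-scale s h _) (*-congˡ (dot-identity h l)))
      (-‿cong (trans (dot-scale s′ h _) (*-congˡ (dot-identity h i)))))
    fz≉0 : ¬ (dot f z ≈ 0#)
    fz≉0 fz≈0 = p (trans (*-comm _ _) (trans (x∙y⁻¹≈ε⇒x≈y _ _ (trans (sym (dot-z f)) fz≈0)) (*-comm _ _)))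
  ... | no p = inj₂ (a , λ z → begin
      dot g z                  ≈⟨ dot-cong g≋af (λ _ → refl) ⟩
      dot (λ k → a * f k) z    ≈⟨ dot-scaleˡ a f z ⟩
      a * dot f z              ∎)
    where
    a = proj₁ (divide (f i) (g i) fi≉0)
    afi≈gi = proj₂ (divide (f i) (g i) fi≉0)
    cross : ∀ l → f l * (f i + g i) ≈ f i * (f l + g l)
    cross l = decidable-stable (_ ≟ _) (λ ne → p (l , ne))
    g≋af : g ≋ (λ k → a * f k)
    g≋af l = *-cancelˡ fi≉0 (begin
      -- The common term `f i * f l` of the vanishing minor cancels, leaving f_i g_l = f_l g_i.
      f i * g l        ≈⟨ Ringₚ.+-cancelˡ ring (f i * f l) _ _ (begin
          f i * f l + f i * g l   ≈⟨ distribˡ (f i) (f l) (g l) ⟨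
          f i * (f l + g l)       ≈⟨ cross l ⟨
          f l * (f i + g i)       ≈⟨ distribˡ (f l) (f i) (g i) ⟩
          f l * f i + f l * g i   ≈⟨ +-congʳ (*-comm (f l) (f i)) ⟩
          f i * f l + f l * g i   ∎) ⟩
      f l * g i        ≈⟨ *-congˡ afi≈gi ⟨
      f l * (a * f i)  ≈⟨ *-comm _ _ ⟩
      (a * f i) * f l  ≈⟨ *-congʳ (*-comm a (f i)) ⟩
      (f i * a) * f l  ≈⟨ *-assoc (f i) a (f l) ⟩
      f i * (a * f l)  ∎)

-- Multiplication by x permutes the nonzero elements, so their product P
-- satisfies P = x^(q-1) P.
fermat : (F : CommutativeRing c ℓ) {q : ℕ} → IsFiniteField F q → let open CommutativeRing F in
         ∀ x → ¬ (x ≈ 0#) → Exp._^_ commutativeSemiring x (q ∸ 1) ≈ 1#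
fermat F {zero} F-field = contradiction (Inverse.to cardinality 0#) Finₚ.¬Fin0
  where
  open CommutativeRing F hiding (zero)
  open IsFiniteField F-field
fermat F {suc q} F-field x x≉0 = *-cancelʳ P≉0 (begin
  x ^′ q * P                                  ≈⟨ *-congʳ (sum-replicate q) ⟨
  sum (replicate q x) * P                     ≈⟨ ∑-distrib-+ (replicate q x) units ⟨
  sum (λ k → x * units k)                     ≈⟨ sum-cong-≋ (λ k → sym (units-permute k)) ⟩
  sum (λ k → units (π′ Perm.⟨$⟩ʳ k))          ≈⟨ sum-permute units π′ ⟨
  P                                           ≈⟨ *-identityˡ P ⟨
  1# * P                                      ∎)
  where
  open CommutativeRing F hiding (zero)
  open Field F F-field
  open Exp commutativeSemiring using () renaming (_^_ to _^′_)
  open Inverse cardinality using (to; from; to-cong; strictlyInverseˡ; strictlyInverseʳ)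
  -- In the multiplicative monoid `sum` is a product, `sum-replicate` yields a power, and
  -- `∑-distrib-+` splits a product of products.
  open MonoidSum *-commutativeMonoid
  open SetoidReasoning setoid

  z : Fin (suc q)
  z = to 0#

  units : Vector Carrier q
  units k = from (punchIn z k)

  units≉0 : ∀ k → ¬ (units k ≈ 0#)
  units≉0 k eq = Finₚ.punchInᵢ≢i z k (≡.trans (≡.sym (strictlyInverseˡ _)) (to-cong eq))

  product≉0 : (t : Vector Carrier n) → (∀ k → ¬ (t k ≈ 0#)) → ¬ (sum t ≈ 0#)
  product≉0 {zero}  t t≉0 = 1≉0
  product≉0 {suc n} t t≉0 = *-nonzero (t≉0 zero) (product≉0 (t ∘ suc) (t≉0 ∘ suc))

  P : Carrier
  P = sum units

  P≉0 : ¬ (P ≈ 0#)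
  P≉0 = product≉0 units units≉0

  t : Carrier
  t = proj₁ (inverse x x≉0)

  cancelled : ∀ u v → u * v ≈ 1# → ∀ i → to (u * from (to (v * from i))) ≡ i
  cancelled u v uv≈1 i = ≡.trans (to-cong (begin
    u * from (to (v * from i))  ≈⟨ *-congˡ (strictlyInverseʳ _) ⟩
    u * (v * from i)            ≈⟨ *-assoc u v _ ⟨
    (u * v) * from i            ≈⟨ *-congʳ uv≈1 ⟩
    1# * from i                 ≈⟨ *-identityˡ _ ⟩
    from i                      ∎)) (strictlyInverseˡ i)

  π : Perm.Permutation′ (suc q)
  π = Perm.permutation (λ i → to (x * from i)) (λ i → to (t * from i))
        (cancelled x t (proj₂ (inverse x x≉0)))
        (cancelled t x (trans (*-comm t x) (proj₂ (inverse x x≉0))))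

  -- Multiplication by `x` fixes the index `z` of 0, so deleting `z` leaves a permutation of the
  -- indices of nonzero elements.
  π′ : Perm.Permutation′ q
  π′ = Perm.remove z π

  πz≡z : π Perm.⟨$⟩ʳ z ≡ z
  πz≡z = to-cong (trans (*-congˡ (strictlyInverseʳ 0#)) (zeroʳ x))

  units-permute : ∀ k → units (π′ Perm.⟨$⟩ʳ k) ≈ x * units k
  units-permute k = begin
    from (punchIn z (π′ Perm.⟨$⟩ʳ k))
      ≡⟨ ≡.cong (λ w → from (punchIn w (π′ Perm.⟨$⟩ʳ k))) πz≡z ⟨
    from (punchIn (π Perm.⟨$⟩ʳ z) (π′ Perm.⟨$⟩ʳ k))
      ≡⟨ ≡.cong from (Perm.punchIn-permute π z k) ⟨
    from (to (x * units k))
      ≈⟨ strictlyInverseʳ _ ⟩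
    x * units k  ∎

-- The multiplicative order of a primitive element.

module PrimitiveElement (L : CommutativeRing c ℓ) {N : ℕ} (L-field : IsFiniteField L N)
                        (γ : CommutativeRing.Carrier L) (γ-prim : IsPrimitive L γ) where
  open CommutativeRing L hiding (zero)
  open Field L L-field
  open IsPrimitive γ-prim
  open Exp commutativeSemiring using (^-homo-*; ^-assocʳ; ^-congˡ) renaming (_^_ to _^′_)
  open MonoidSum *-commutativeMonoid using (sum-replicate; sum-replicate-zero)
  open Inverse cardinality using (from; to; strictlyInverseˡ; to-cong)
  open SetoidReasoning setoid

  1^n≈1 : ∀ n → 1# ^′ n ≈ 1#
  1^n≈1 n = trans (sym (sum-replicate n)) (sum-replicate-zero n)

  γ^k≈γ^[k%n] : ∀ n .{{_ : ℕ.NonZero n}} → γ ^′ n ≈ 1# → ∀ k → γ ^′ k ≈ γ ^′ (k % n)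
  γ^k≈γ^[k%n] n γ^n≈1 k = begin
    γ ^′ k                               ≡⟨ ≡.cong (γ ^′_) (m≡m%n+[m/n]*n k n) ⟩
    γ ^′ (k % n ℕ.+ k / n ℕ.* n)         ≈⟨ ^-homo-* γ (k % n) _ ⟩
    γ ^′ (k % n) * γ ^′ (k / n ℕ.* n)    ≡⟨ ≡.cong (λ e → γ ^′ (k % n) * γ ^′ e) (ℕₚ.*-comm (k / n) n) ⟩
    γ ^′ (k % n) * γ ^′ (n ℕ.* (k / n))  ≈⟨ *-congˡ (^-assocʳ γ n (k / n)) ⟨
    γ ^′ (k % n) * (γ ^′ n) ^′ (k / n)   ≈⟨ *-congˡ (trans (^-congˡ (k / n) γ^n≈1) (1^n≈1 (k / n))) ⟩
    γ ^′ (k % n) * 1#                    ≈⟨ *-identityʳ _ ⟩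
    γ ^′ (k % n)                         ∎

  -- If γⁿ = 1 then every element is 0 or one of γ⁰, …, γⁿ⁻¹.
  order-lowerBound : ∀ n .{{_ : ℕ.NonZero n}} → γ ^′ n ≈ 1# → N ≤ suc n
  order-lowerBound n γ^n≈1 = Finₚ.injective⇒≤ {f = index ∘ from} injective
    where
    index′ : ∀ x → Dec (x ≈ 0#) → Fin (suc n)
    index′ x (yes _)  = zero
    index′ x (no x≉0) = suc (fromℕ< (m%n<n (proj₁ (generates x x≉0)) n))

    index : Carrier → Fin (suc n)
    index x = index′ x (x ≟ 0#)

    -- Quantifying over the decisions allows matching on them directly; in the mixed cases `zero`
    -- would equal a `suc`, so they need no clause.
    index′-injective : ∀ x y x? y? → index′ x x? ≡ index′ y y? → x ≈ y
    index′-injective x y (yes x≈0) (yes y≈0) _  = trans x≈0 (sym y≈0)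
    index′-injective x y (no x≉0)  (no y≉0)  eq with k , x≈γ^k ← generates x x≉0 | l , y≈γ^l ← generates y y≉0 = begin
      x             ≈⟨ x≈γ^k ⟩
      γ ^′ k        ≈⟨ γ^k≈γ^[k%n] n γ^n≈1 k ⟩
      γ ^′ (k % n)  ≡⟨ ≡.cong (γ ^′_) (Finₚ.fromℕ<-injective _ _ (m%n<n k n) (m%n<n l n) (Finₚ.suc-injective eq)) ⟩
      γ ^′ (l % n)  ≈⟨ γ^k≈γ^[k%n] n γ^n≈1 l ⟨
      γ ^′ l        ≈⟨ y≈γ^l ⟨
      y             ∎

    injective : Injective _≡_ _≡_ (index ∘ from)
    injective {i} {j} eq = ≡.trans (≡.sym (strictlyInverseˡ i))
      (≡.trans (to-cong (index′-injective (from i) (from j) _ _ eq)) (strictlyInverseˡ j))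

  -- By Fermat the exponent may be reduced modulo `N ∸ 1`. A positive remainder e would give N ≤ e +
  -- 1 by `order-lowerBound`, against e < N - 1.
  order-∣ : ∀ m → γ ^′ m ≈ 1# → N ∸ 1 ∣ m
  order-∣ m γ^m≈1 = m%n≡0⇒n∣m m (N ∸ 1) (remainder≡0 (m % (N ∸ 1)) (m%n<n m (N ∸ 1)) (begin
    γ ^′ (m % (N ∸ 1))  ≈⟨ γ^k≈γ^[k%n] (N ∸ 1) (fermat L L-field γ nonzero) m ⟨
    γ ^′ m              ≈⟨ γ^m≈1 ⟩
    1#                  ∎))
    where
    instance
      N∸1≢0 : ℕ.NonZero (N ∸ 1)
      N∸1≢0 = ℕ.>-nonZero (ℕₚ.m<n⇒0<n∸m 1<q)

    remainder≡0 : ∀ e → e < N ∸ 1 → γ ^′ e ≈ 1# → e ≡ 0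
    remainder≡0 zero    _     _     = ≡.refl
    remainder≡0 (suc e) e<N∸1 γ^e≈1 =
      contradiction (ℕₚ.∸-monoˡ-≤ 1 (order-lowerBound (suc e) γ^e≈1)) (ℕₚ.<⇒≱ e<N∸1)

-- Divisibility by repunits.

-- Induction through Q^(r+1) - 1 = (Q - 1) + Q (Q^r - 1). Once the base Q is matched as `suc q`, the
-- divisor is `q` itself.
q∸1∣q^r∸1 : ∀ q r → 1 ≤ q → q ∸ 1 ∣ q ^ r ∸ 1
q∸1∣q^r∸1 (suc q) zero    _   = q ∣0
q∸1∣q^r∸1 (suc q) (suc r) 1≤q = ≡.subst (q ∣_) eq
  (∣m∣n⇒∣m+n ∣-refl (∣n⇒∣m*n (suc q) (q∸1∣q^r∸1 (suc q) r 1≤q)))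
  where
  open ≡.≡-Reasoning
  p = suc q ^ r
  1≤p : 1 ≤ p
  1≤p = ℕₚ.m^n>0 (suc q) r
  eq : q ℕ.+ suc q ℕ.* (p ∸ 1) ≡ suc q ℕ.* p ∸ 1
  eq = begin
    q ℕ.+ suc q ℕ.* (p ∸ 1)          ≡⟨⟩
    (suc q ℕ.+ suc q ℕ.* (p ∸ 1)) ∸ 1  ≡⟨ ≡.cong (_∸ 1) (ℕₚ.*-suc (suc q) (p ∸ 1)) ⟨
    suc q ℕ.* suc (p ∸ 1) ∸ 1        ≡⟨ ≡.cong (λ e → suc q ℕ.* e ∸ 1) (ℕₚ.m+[n∸m]≡n 1≤p) ⟩
    suc q ℕ.* p ∸ 1                  ∎

-- The truncating division in `repunit` is exact, so `q ^ r ∸ 1` is the repunit times `q ∸ 1`, and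
-- that factor cancels.
repunit-∣ : ∀ {q} (q-pp : IsPrimePower q) r d → q ^ r ∸ 1 ∣ d ℕ.* (q ∸ 1) → repunit q q-pp r ∣ d
repunit-∣ {q} q-pp r d div = *-cancelʳ-∣ (q ∸ 1) (≡.subst (_∣ d ℕ.* (q ∸ 1)) (≡.sym (m/n*n≡m (q∸1∣q^r∸1 q r 1≤q))) div)
  where
  instance
    q∸1≢0 : ℕ.NonZero (q ∸ 1)
    q∸1≢0 = primePower⇒nonZero q-pp
  1≤q : 1 ≤ q
  1≤q = ℕₚ.<⇒≤ (ℕₚ.m∸n≢0⇒n<m (ℕ.≢-nonZero⁻¹ (q ∸ 1)))

-- The extension field as a coordinate space on which M is multiplication by γ.

module Extension
  {q r : ℕ} (1≤r : 1 ≤ r)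
  (F : CommutativeRing c ℓ) (F-field : IsFiniteField F q)
  (L : CommutativeRing c′ ℓ′) (L-field : IsFiniteField L (q ^ r))
  (ι : CommutativeRing.Carrier F → CommutativeRing.Carrier L)
  (ι-hom : IsRingHomomorphism (CommutativeRing.rawRing F) (CommutativeRing.rawRing L) ι)
  (γ : CommutativeRing.Carrier L) (γ-prim : IsPrimitive L γ)
  (μ : Vector (CommutativeRing.Carrier F) r) (μ-min : IsMinimalPolynomial F L ι γ μ)
  where

  private
    module F = CommutativeRing F
    module Fᶠ = Field F F-field
    module FD = DotProduct F
  open CommutativeRing L hiding (zero)
  open Field L L-field
  open DotProduct L
  open SemiringSum semiring using (sum; sum-cong-≋; sum-init-last)
  open Exp commutativeSemiring using (^-homo-*; ^-assocʳ; ^-congʳ; ^-congˡ; ^-distrib-*) renaming (_^_ to _^′_)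
  open IsRingHomomorphism ι-hom
  open IsPrimitive γ-prim
  open IsMinimalPolynomial μ-min
  open PrimitiveElement L L-field γ γ-prim
  open VecEq F.setoid using () renaming (_≋_ to _≋ᶠ_)
  open SetoidReasoning setoid

  ι-sum : (t : Vector F.Carrier n) → ι (SemiringSum.sum F.semiring t) ≈ sum (ι ∘ t)
  ι-sum {zero}  t = 0#-homo
  ι-sum {suc n} t = trans (+-homo _ _) (+-congˡ (ι-sum (t ∘ suc)))

  ι-identity : ∀ n i k → ι (identity F n i k) ≈ identity L n i k
  ι-identity n i k with toℕ i ℕ.≡ᵇ toℕ k
  ... | true  = 1#-homo
  ... | false = 0#-homo

  ι-^ : ∀ a n → ι (Exp._^_ F.commutativeSemiring a n) ≈ ι a ^′ n
  ι-^ a zero    = 1#-homo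
  ι-^ a (suc n) = trans (*-homo a _) (*-congˡ (ι-^ a n))

  powers : Vector Carrier n
  powers k = γ ^′ toℕ k

  -- Evaluation at γ of the polynomial with coefficients `x`; `evalMonic` at γ is then γ^n + φ. The
  -- length is left free because the kernel is computed by induction on it.
  φ : Vector F.Carrier n → Carrier
  φ x = dot (ι ∘ x) powers

  φ-cong : {x y : Vector F.Carrier n} → x ≋ᶠ y → φ x ≈ φ y
  φ-cong x≋y = dot-cong (λ k → ⟦⟧-cong (x≋y k)) (λ _ → refl)

  φ-scale : ∀ a (x : Vector F.Carrier n) → φ (λ k → a F.* x k) ≈ ι a * φ x
  φ-scale a x = trans (dot-cong (λ k → *-homo a (x k)) (λ _ → refl)) (dot-scaleˡ (ι a) (ι ∘ x) powers)

  φ-neg : (x : Vector F.Carrier n) → φ (λ k → F.- x k) ≈ - φ x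
  φ-neg x = trans (dot-cong (λ k → -‿homo (x k)) (λ _ → refl)) (dot-negˡ (ι ∘ x) powers)

  φ-minus : (x y : Vector F.Carrier n) → φ (λ k → x k F.- y k) ≈ φ x - φ y
  φ-minus x y = trans (dot-cong (λ k → trans (+-homo (x k) _) (+-congˡ (-‿homo (y k)))) (λ _ → refl))
                      (dot-minusˡ (ι ∘ x) (ι ∘ y) powers)

  φ-zero : (x : Vector F.Carrier n) → x ≋ᶠ 0ⱽ F → φ x ≈ 0#
  φ-zero x x≋0 = dot-zeroˡ powers (λ k → trans (⟦⟧-cong (x≋0 k)) 0#-homo)

  -- Under `φ` a matrix acts through the images of its rows, so the action of M need only be checked
  -- row by row.
  φ-vecMul : (x : Vector F.Carrier m) (A : Matrix F m n) → φ (vecMul F x A) ≈ dot (ι ∘ x) (φ ∘ A)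
  φ-vecMul x A = trans
    (dot-cong (λ k → trans (ι-sum (λ i → x i F.* A i k)) (sum-cong-≋ (λ i → *-homo (x i) (A i k)))) (λ _ → refl))
    (dot-lincombˡ (ι ∘ x) (λ i → ι ∘ A i) powers)

  φ-basis : (i : Fin n) → φ (λ k → identity F n k i) ≈ γ ^′ toℕ i
  φ-basis {n} i = trans (dot-cong (λ k → ι-identity n k i) (λ _ → refl)) (dot-identityˡ powers i)

  -- Every row but the last is the next unit vector. The last one represents -φ(μ), which is γ^r
  -- because γ is a root.
  φ-companion : ∀ i → φ (companion F μ i) ≈ γ * γ ^′ toℕ i
  φ-companion i with suc (toℕ i) ℕₚ.≟ r
  ... | yes 1+i≡r = begin
    φ (companion F μ i)        ≈⟨ φ-cong (λ k → F.reflexive (lastRow k)) ⟩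
    φ (λ k → F.- μ k)          ≈⟨ φ-neg μ ⟩
    - φ μ                      ≈⟨ Ringₚ.+-inverseˡ-unique ring (γ ^′ r) (φ μ) root ⟨
    γ ^′ r                     ≡⟨ ≡.cong (γ ^′_) 1+i≡r ⟨
    γ * γ ^′ toℕ i             ∎
    where
    lastRow : ∀ k → companion F μ i k ≡ F.- μ k
    lastRow k rewrite dec-true (suc (toℕ i) ℕₚ.≟ r) 1+i≡r = ≡.refl
  ... | no 1+i≢r = begin
    φ (companion F μ i)          ≈⟨ φ-cong (λ k → F.reflexive (shiftRow k)) ⟩
    φ (λ k → identity F r k 1+i) ≈⟨ φ-basis 1+i ⟩
    γ ^′ toℕ 1+i                 ≡⟨ ≡.cong (γ ^′_) (Finₚ.toℕ-fromℕ< 1+i<r) ⟩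
    γ * γ ^′ toℕ i               ∎
    where
    1+i<r : suc (toℕ i) < r
    1+i<r = ℕₚ.≤∧≢⇒< (Finₚ.toℕ<n i) 1+i≢r
    1+i : Fin r
    1+i = fromℕ< 1+i<r
    shiftRow : ∀ k → companion F μ i k ≡ identity F r k 1+i
    shiftRow k rewrite dec-false (suc (toℕ i) ℕₚ.≟ r) 1+i≢r | Finₚ.toℕ-fromℕ< 1+i<r = ≡.refl

  M : Matrix F r r
  M = companion F μ

  φ-vecMul-companion : ∀ x → φ (vecMul F x M) ≈ φ x * γ
  φ-vecMul-companion x = begin
    φ (vecMul F x M)                    ≈⟨ φ-vecMul x M ⟩
    dot (ι ∘ x) (φ ∘ M)                 ≈⟨ dot-congˡ (ι ∘ x) φ-companion ⟩
    dot (ι ∘ x) (λ k → γ * powers k)    ≈⟨ dot-scale γ (ι ∘ x) powers ⟩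
    γ * φ x                             ≈⟨ *-comm γ _ ⟩
    φ x * γ                             ∎

  -- `matPow` multiplies by M on the left, so one step replaces `x` by xM; hence the induction on
  -- `e` runs over all `x`.
  φ-vecMul-matPow : ∀ e x → φ (vecMul F x (matPow F M e)) ≈ φ x * γ ^′ e
  φ-vecMul-matPow zero    x = trans (φ-cong (FD.vecMul-identity x)) (sym (*-identityʳ _))
  φ-vecMul-matPow (suc e) x = begin
    φ (vecMul F x (matMul F M (matPow F M e)))     ≈⟨ φ-cong (FD.vecMul-matMul x M (matPow F M e)) ⟩
    φ (vecMul F (vecMul F x M) (matPow F M e))     ≈⟨ φ-vecMul-matPow e (vecMul F x M) ⟩
    φ (vecMul F x M) * γ ^′ e                      ≈⟨ *-congʳ (φ-vecMul-companion x) ⟩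
    (φ x * γ) * γ ^′ e                             ≈⟨ *-assoc _ γ _ ⟩
    φ x * γ ^′ suc e                               ∎

  -- No dimension count: a nonzero ζ is some γ^e, the image of the first unit vector (representing
  -- 1) times M^e.
  φ-surjective : ∀ ζ → ∃ λ (x : Vector F.Carrier r) → φ x ≈ ζ
  φ-surjective ζ with ζ ≟ 0#
  ... | yes ζ≈0 = 0ⱽ F , trans (φ-zero (0ⱽ F {n = r}) (λ _ → F.refl)) (sym ζ≈0)
  ... | no ζ≉0 with e , ζ≈γ^e ← generates ζ ζ≉0 = vecMul F one (matPow F M e) , (begin
    φ (vecMul F one (matPow F M e))  ≈⟨ φ-vecMul-matPow e one ⟩
    φ one * γ ^′ e                   ≈⟨ *-congʳ (φ-basis (fromℕ< 1≤r)) ⟩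
    γ ^′ toℕ (fromℕ< 1≤r) * γ ^′ e   ≡⟨ ≡.cong (λ z → γ ^′ z * γ ^′ e) (Finₚ.toℕ-fromℕ< 1≤r) ⟩
    1# * γ ^′ e                      ≈⟨ *-identityˡ _ ⟩
    γ ^′ e                           ≈⟨ ζ≈γ^e ⟨
    ζ                                ∎)
    where
    one : Vector F.Carrier r
    one k = identity F r k (fromℕ< 1≤r)

  φ-init-last : (x : Vector F.Carrier (suc n)) → φ x ≈ φ (init x) + ι (last x) * γ ^′ n
  φ-init-last {n} x = begin
    φ x
      ≈⟨ sum-init-last (λ k → ι (x k) * γ ^′ toℕ k) ⟩
    sum (λ k → ι (init x k) * γ ^′ toℕ (inject₁ k)) + ι (last x) * γ ^′ toℕ (fromℕ n)
      ≈⟨ +-cong (sum-cong-≋ {n} (λ k → *-congˡ (^-congʳ γ (Finₚ.toℕ-inject₁ k)))) (*-congˡ (^-congʳ γ (Finₚ.toℕ-fromℕ n))) ⟩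
    φ (init x) + ι (last x) * γ ^′ n  ∎

  -- A nonzero leading coefficient could be normalised to 1, contradicting minimality.
  φ-kernel : n ≤ r → (x : Vector F.Carrier n) → φ x ≈ 0# → x ≋ᶠ 0ⱽ F
  φ-kernel {zero}  _   x φx≈0 ()
  φ-kernel {suc n} n<r x φx≈0 with last x Fᶠ.≟ F.0#
  ... | yes last≈0 = zeroAt
    where
    init≋0 : init x ≋ᶠ 0ⱽ F
    init≋0 = φ-kernel (ℕₚ.<⇒≤ n<r) (init x) (begin
      φ (init x)                        ≈⟨ +-identityʳ _ ⟨
      φ (init x) + 0#                   ≈⟨ +-congˡ (trans (*-congʳ (trans (⟦⟧-cong last≈0) 0#-homo)) (zeroˡ _)) ⟨
      φ (init x) + ι (last x) * γ ^′ n  ≈⟨ φ-init-last x ⟨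
      φ x                               ≈⟨ φx≈0 ⟩
      0#                                ∎)
    zeroAt : ∀ k → x k F.≈ F.0#
    zeroAt k with view k
    ... | ‵fromℕ     = last≈0
    ... | ‵inject₁ j = init≋0 j
  ... | no last≉0 with t , t*last≈1 ← Fᶠ.divide (last x) F.1# last≉0 = contradiction (begin
      γ ^′ n + φ (λ k → t F.* init x k)                ≈⟨ +-cong (*-identityˡ _) (sym (φ-scale t (init x))) ⟨
      1# * γ ^′ n + ι t * φ (init x)                   ≈⟨ +-congʳ (*-congʳ (trans (sym (*-homo t _)) (trans (⟦⟧-cong t*last≈1) 1#-homo))) ⟨
      (ι t * ι (last x)) * γ ^′ n + ι t * φ (init x)   ≈⟨ +-congʳ (*-assoc _ _ _) ⟩
      ι t * (ι (last x) * γ ^′ n) + ι t * φ (init x)   ≈⟨ distribˡ (ι t) _ _ ⟨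
      ι t * (ι (last x) * γ ^′ n + φ (init x))         ≈⟨ *-congˡ (+-comm _ _) ⟩
      ι t * (φ (init x) + ι (last x) * γ ^′ n)         ≈⟨ *-congˡ (φ-init-last x) ⟨
      ι t * φ x                                        ≈⟨ *-congˡ φx≈0 ⟩
      ι t * 0#                                         ≈⟨ zeroʳ (ι t) ⟩
      0#                                               ∎)
      (minimal n n<r (λ k → t F.* init x k))

  φ-injective : (x y : Vector F.Carrier r) → φ x ≈ φ y → x ≋ᶠ y
  φ-injective x y φx≈φy k = Ringₚ.x∙y⁻¹≈ε⇒x≈y F.ring _ _
    (φ-kernel ℕₚ.≤-refl (λ k → x k F.- y k)
      (trans (φ-minus x y) (trans (+-congʳ φx≈φy) (-‿inverseʳ _))) k)

  -- Surjectivity of M^e is read off in L: divide φ(y) by γ^e and pull the quotient back through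
  -- `φ`.
  solve-vecMul-matPow : ∀ e y → ∃ λ x → vecMul F x (matPow F M e) ≋ᶠ y
  solve-vecMul-matPow e y
    with t , tγ^e≈φy ← divide (γ ^′ e) (φ y) (^-nonzero nonzero e)
    with x , φx≈t ← φ-surjective t
    = x , φ-injective _ y (trans (φ-vecMul-matPow e x) (trans (*-congʳ φx≈t) tγ^e≈φy))

  -- a x Mʲ - b x Mⁱ is multiplication of x by D = ι(a)γʲ - ι(b)γⁱ, and g
  -- vanishes on it; as g ≠ 0, D = 0 and γʲ⁻ⁱ lies in the subfield F.
  proportional⇒order : (f g : Vector F.Carrier r) → ¬ (g ≋ᶠ 0ⱽ F) → ∀ {i j} → i ≤ j → ∀ a b →
    (∀ z → FD.dot g (vecMul F z (matPow F M i)) F.≈ a F.* FD.dot f z) →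
    (∀ z → FD.dot g (vecMul F z (matPow F M j)) F.≈ b F.* FD.dot f z) →
    q ^ r ∸ 1 ∣ (j ∸ i) ℕ.* (q ∸ 1)
  proportional⇒order f g g≉0 {i} {j} i≤j a b g-i g-j = order-∣ ((j ∸ i) ℕ.* (q ∸ 1)) (begin
    γ ^′ ((j ∸ i) ℕ.* (q ∸ 1))              ≈⟨ ^-assocʳ γ (j ∸ i) (q ∸ 1) ⟨
    (γ ^′ (j ∸ i)) ^′ (q ∸ 1)               ≈⟨ *-identityˡ _ ⟨
    1# * (γ ^′ (j ∸ i)) ^′ (q ∸ 1)          ≈⟨ *-congʳ (ι-fermat a≉0) ⟨
    ι a ^′ (q ∸ 1) * (γ ^′ (j ∸ i)) ^′ (q ∸ 1)  ≈⟨ ^-distrib-* (ι a) (γ ^′ (j ∸ i)) (q ∸ 1) ⟨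
    (ι a * γ ^′ (j ∸ i)) ^′ (q ∸ 1)         ≈⟨ ^-congˡ (q ∸ 1) ratio ⟩
    ι b ^′ (q ∸ 1)                          ≈⟨ ι-fermat b≉0 ⟩
    1#                                      ∎)
    where
    module FR = SetoidReasoning F.setoid

    y : Vector F.Carrier r
    y k = identity F r k (proj₁ (Fᶠ.nonzeroEntry g≉0))

    gy≉0 : ¬ (FD.dot g y F.≈ F.0#)
    gy≉0 gy≈0 = proj₂ (Fᶠ.nonzeroEntry g≉0) (F.trans (F.sym (FD.dot-identity g _)) gy≈0)

    -- The vector `y`, where `g` is nonzero, has the form zM^e; a zero factor `t` would make g(y)
    -- vanish.
    coefficient≉0 : ∀ e t → (∀ z → FD.dot g (vecMul F z (matPow F M e)) F.≈ t F.* FD.dot f z) → ¬ (t F.≈ F.0#)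
    coefficient≉0 e t g-e t≈0 with z , zMᵉ≋y ← solve-vecMul-matPow e y = gy≉0 (FR.begin
      FD.dot g y                            FR.≈⟨ FD.dot-congˡ g zMᵉ≋y ⟨
      FD.dot g (vecMul F z (matPow F M e))  FR.≈⟨ g-e z ⟩
      t F.* FD.dot f z                      FR.≈⟨ F.*-congʳ t≈0 ⟩
      F.0# F.* FD.dot f z                   FR.≈⟨ F.zeroˡ _ ⟩
      F.0#                                  FR.∎)

    a≉0 = coefficient≉0 i a g-i
    b≉0 = coefficient≉0 j b g-j

    -- Raising `ratio` to the power `q ∸ 1` thus removes both `ι a` and `ι b`.
    ι-fermat : ∀ {t} → ¬ (t F.≈ F.0#) → ι t ^′ (q ∸ 1) ≈ 1#
    ι-fermat {t} t≉0 = trans (sym (ι-^ t (q ∸ 1))) (trans (⟦⟧-cong (fermat F F-field t t≉0)) 1#-homo)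

    D : Carrier
    D = ι a * γ ^′ j - ι b * γ ^′ i

    D≈0 : D ≈ 0#
    D≈0 with D ≟ 0#
    ... | yes D≈0 = D≈0
    -- Solving φ(z) D = φ(y) gives y = a zMʲ - b zMⁱ, where `g` takes the value ab f(z) - ba f(z) =
    -- 0, although g(y) is nonzero.
    ... | no D≉0
      with t , tD≈φy ← divide D (φ y) D≉0
      with z , φz≈t ← φ-surjective t
      = contradiction gy≈0 gy≉0
      where
      zMⁱ = vecMul F z (matPow F M i)
      zMʲ = vecMul F z (matPow F M j)
      u : Vector F.Carrier r
      u k = a F.* zMʲ k F.- b F.* zMⁱ k
      φ-term : ∀ d e → φ (λ k → d F.* vecMul F z (matPow F M e) k) ≈ φ z * (ι d * γ ^′ e)
      φ-term d e = begin
        φ (λ k → d F.* vecMul F z (matPow F M e) k)  ≈⟨ φ-scale d (vecMul F z (matPow F M e)) ⟩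
        ι d * φ (vecMul F z (matPow F M e))          ≈⟨ *-congˡ (φ-vecMul-matPow e z) ⟩
        ι d * (φ z * γ ^′ e)                         ≈⟨ Semigroupₚ.x∙yz≈y∙xz *-commutativeSemigroup _ _ _ ⟩
        φ z * (ι d * γ ^′ e)                         ∎
      φu≈φy : φ u ≈ φ y
      φu≈φy = begin
        φ u                                                    ≈⟨ φ-minus (λ k → a F.* zMʲ k) (λ k → b F.* zMⁱ k) ⟩
        φ (λ k → a F.* zMʲ k) - φ (λ k → b F.* zMⁱ k)          ≈⟨ +-cong (φ-term a j) (-‿cong (φ-term b i)) ⟩
        φ z * (ι a * γ ^′ j) - φ z * (ι b * γ ^′ i)            ≈⟨ Ringₚ.x[y-z]≈xy-xz ring _ _ _ ⟨
        φ z * D                                                ≈⟨ *-congʳ φz≈t ⟩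
        t * D                                                  ≈⟨ tD≈φy ⟩
        φ y                                                    ∎
      gy≈0 : FD.dot g y F.≈ F.0#
      gy≈0 = FR.begin
        FD.dot g y                                             FR.≈⟨ FD.dot-congˡ g (φ-injective u y φu≈φy) ⟨
        FD.dot g u                                             FR.≈⟨ FD.dot-minus g _ _ ⟩
        FD.dot g (λ k → a F.* zMʲ k) F.- FD.dot g (λ k → b F.* zMⁱ k)
          FR.≈⟨ F.+-cong (FD.dot-scale a g zMʲ) (F.-‿cong (FD.dot-scale b g zMⁱ)) ⟩
        a F.* FD.dot g zMʲ F.- b F.* FD.dot g zMⁱ
          FR.≈⟨ F.+-cong (F.*-congˡ (g-j z)) (F.-‿cong (F.*-congˡ (g-i z))) ⟩
        a F.* (b F.* FD.dot f z) F.- b F.* (a F.* FD.dot f z)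
          FR.≈⟨ F.+-congʳ (Semigroupₚ.x∙yz≈y∙xz F.*-commutativeSemigroup _ _ _) ⟩
        b F.* (a F.* FD.dot f z) F.- b F.* (a F.* FD.dot f z)  FR.≈⟨ F.-‿inverseʳ _ ⟩
        F.0#                                                   FR.∎

    ratio : ι a * γ ^′ (j ∸ i) ≈ ι b
    ratio = *-cancelʳ (^-nonzero nonzero i) (begin
      (ι a * γ ^′ (j ∸ i)) * γ ^′ i   ≈⟨ *-assoc _ _ _ ⟩
      ι a * (γ ^′ (j ∸ i) * γ ^′ i)   ≈⟨ *-congˡ (^-homo-* γ (j ∸ i) i) ⟨
      ι a * γ ^′ (j ∸ i ℕ.+ i)        ≡⟨ ≡.cong (λ e → ι a * γ ^′ e) (ℕₚ.m∸n+n≡m i≤j) ⟩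
      ι a * γ ^′ j                    ≈⟨ Ringₚ.x∙y⁻¹≈ε⇒x≈y ring _ _ D≈0 ⟩
      ι b * γ ^′ i                    ∎)

-- Projective spans, and hyperplanes as kernels.

module ProjectiveGeometry {q : ℕ} (F : CommutativeRing c ℓ) (F-field : IsFiniteField F q) where
  open CommutativeRing F hiding (zero)
  open Field F F-field
  open DotProduct F
  open VecEq setoid using (_≋_)
  open SetoidReasoning setoid
  open Point

  -- `ProjectiveSpan` for vectors instead of points, because partial sums of a decomposition may be
  -- zero.
  SpannedBy : Pred (Point F n) ℓ″ → Pred (Vector Carrier n) _
  SpannedBy {n = n} S v =
    ∃ λ m → Σ (Vector (Point F n) m) λ Q → (∀ k → S (Q k)) × InLinearSpan F v (λ k → vec (Q k))

  spannedBy-cong : (S : Pred (Point F n) ℓ″) {v w : Vector Carrier n} → v ≋ w → SpannedBy S v → SpannedBy S w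
  spannedBy-cong S v≋w (m , Q , Q∈S , a , v≋aQ) = m , Q , Q∈S , a , λ i → trans (sym (v≋w i)) (v≋aQ i)

  spannedBy-0 : (S : Pred (Point F n) ℓ″) → SpannedBy S (0ⱽ F)
  spannedBy-0 S = 0 , (λ ()) , (λ ()) , (λ ()) , λ _ → refl

  -- A summand that vanishes is no point and is dropped; hence membership of `w` in `S` is asked
  -- only relative to a proof that `w` is nonzero.
  spannedBy-+ : (S : Pred (Point F n) ℓ″) {v : Vector Carrier n} (w : Vector Carrier n) →
                (∀ w≉0 → S (record { vec = w ; nonzero = w≉0 })) → SpannedBy S v → SpannedBy S (λ i → w i + v i)
  spannedBy-+ {n = n} S {v} w w∈S (m , Q , Q∈S , a , v≋aQ) with ≋0? w
  ... | yes w≋0 = spannedBy-cong S (λ i → sym (trans (+-congʳ (w≋0 i)) (+-identityˡ (v i)))) (m , Q , Q∈S , a , v≋aQ)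
  ... | no w≉0 = suc m , P ∷ Q , P∷Q∈S , 1# ∷ a , λ i → +-cong (sym (*-identityˡ (w i))) (v≋aQ i)
    where
    P : Point F n
    P = record { vec = w ; nonzero = w≉0 }
    P∷Q∈S : ∀ k → S ((P ∷ Q) k)
    P∷Q∈S zero    = w∈S w≉0
    P∷Q∈S (suc k) = Q∈S k

  ∼-refl : {v : Vector Carrier n} → _∼_ F v v
  ∼-refl {v = v} = 1# , 1≉0 , λ i → sym (*-identityˡ (v i))

  ++-≋0 : {x : Vector Carrier m} {y : Vector Carrier n} → x ≋ 0ⱽ F → y ≋ 0ⱽ F → (x ++ y) ≋ 0ⱽ F
  ++-≋0 {m = m} x≋0 y≋0 i with splitAt m i
  ... | inj₁ k = x≋0 k
  ... | inj₂ k = y≋0 k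

  vecMul-0 : {x : Vector Carrier m} (A : Matrix F m n) → x ≋ 0ⱽ F → vecMul F x A ≋ 0ⱽ F
  vecMul-0 A x≋0 k = dot-zeroˡ (λ i → A i k) x≋0

  V₀-intro : (x : Vector Carrier r) → ∀ nz → V₀ F r (record { vec = x ++ 0ⱽ F {n = r} ; nonzero = nz })
  V₀-intro x nz = record { vec = x ; nonzero = λ x≋0 → nz (++-≋0 x≋0 (λ _ → refl)) } , ∼-refl

  V∞-intro : (y : Vector Carrier r) → ∀ nz → V∞ F r (record { vec = 0ⱽ F {n = r} ++ y ; nonzero = nz })
  V∞-intro {r = r} y nz = record { vec = y ; nonzero = λ y≋0 → nz (++-≋0 {m = r} (λ _ → refl) y≋0) } , ∼-refl

  V-intro : (M : Matrix F r r) (e : ℕ) (x : Vector Carrier r) →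
            ∀ nz → V F M e (record { vec = x ++ vecMul F x (matPow F M e) ; nonzero = nz })
  V-intro M e x nz = record { vec = x ; nonzero = λ x≋0 → nz (++-≋0 x≋0 (vecMul-0 (matPow F M e) x≋0)) } , ∼-refl

  dot-lincomb≈0 : (h : Vector Carrier n) (b : Vector (Vector Carrier n) m) → (∀ k → dot h (b k) ≈ 0#) →
                  ∀ {v} → InLinearSpan F v b → dot h v ≈ 0#
  dot-lincomb≈0 h b hb≈0 (a , v≋ab) =
    trans (dot-congˡ h v≋ab) (trans (dot-lincomb h a b) (dot-zeroʳ a hb≈0))

  -- A hyperplane comes with a basis, which `hyperplaneFunctional` trades for an equation. Kernels
  -- are closed under linear combinations, giving one inclusion; the assumption on `S` gives the
  -- other.
  cuttingBlockingSet-criterion : (S : Pred (Point F (suc n)) ℓ″) →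
    (∀ h v → dot h v ≈ 0# → SpannedBy (S ∩ (λ P → dot h (vec P) ≈ 0#)) v) →
    IsCuttingBlockingSet F S
  cuttingBlockingSet-criterion S spanned H (b , b-indep , H⊆⟨b⟩ , ⟨b⟩⊆H) =
    viaFunctional (hyperplaneFunctional b b-indep)
    where
    viaFunctional : ∃ (λ h → (∀ k → dot h (b k) ≈ 0#) × (∀ v → dot h v ≈ 0# → InLinearSpan F v b)) →
                    ProjectiveSpan F (S ∩ H) ≐ H
    viaFunctional (h , hb≈0 , ker⊆⟨b⟩) = ⟨S∩H⟩⊆H , H⊆⟨S∩H⟩
      where
      H⊆ker : ∀ {P} → H P → dot h (vec P) ≈ 0#
      H⊆ker P∈H = dot-lincomb≈0 h b hb≈0 (H⊆⟨b⟩ P∈H)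

      ker⊆H : ∀ {P} → dot h (vec P) ≈ 0# → H P
      ker⊆H {P} hP≈0 = ⟨b⟩⊆H (ker⊆⟨b⟩ (vec P) hP≈0)

      ⟨S∩H⟩⊆H : ∀ {P} → ProjectiveSpan F (S ∩ H) P → H P
      ⟨S∩H⟩⊆H {P} (m , Q , Q∈S∩H , P∈⟨Q⟩) =
        ker⊆H {P} (dot-lincomb≈0 h (λ k → vec (Q k)) (λ k → H⊆ker {Q k} (proj₂ (Q∈S∩H k))) P∈⟨Q⟩)

      H⊆⟨S∩H⟩ : ∀ {P} → H P → ProjectiveSpan F (S ∩ H) P
      H⊆⟨S∩H⟩ {P} P∈H =
        let m , Q , Q∈S∩ker , P∈⟨Q⟩ = spanned h (vec P) (H⊆ker {P} P∈H) in
        m , Q , (λ k → proj₁ (Q∈S∩ker k) , ker⊆H {Q k} (proj₂ (Q∈S∩ker k))) , P∈⟨Q⟩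

  -- The dichotomy for `f` and the pullback of `g` along `A`, whose coordinates are `dot g (A k)`.
  -- In the first case `z` is rescaled by α / f(z).
  hitsGraph⊎proportional : (A : Matrix F m m) (f g : Vector Carrier m) → ¬ (f ≋ 0ⱽ F) → ∀ α →
    (∃ λ z → dot f z ≈ α × dot g (vecMul F z A) ≈ - α) ⊎
    (∃ λ a → ∀ z → dot g (vecMul F z A) ≈ a * dot f z)
  hitsGraph⊎proportional {m = m} A f g f≉0 α with separate⊎proportional f (λ k → dot g (A k)) f≉0
  ... | inj₂ (a , gA≈af) = inj₂ (a , λ z → trans (dot-lincomb g z A) (trans (dot-comm z _) (gA≈af z)))
  ... | inj₁ (z , fz≉0 , sum≈0) with t , tfz≈α ← divide (dot f z) α fz≉0 = inj₁
    ( (λ k → t * z k)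
    , trans (dot-scale t f z) tfz≈α
    , (begin
      dot g (vecMul F (λ k → t * z k) A)           ≈⟨ dot-lincomb g (λ k → t * z k) A ⟩
      dot (λ k → t * z k) (λ k → dot g (A k))      ≈⟨ dot-scaleˡ t z (λ k → dot g (A k)) ⟩
      t * dot z (λ k → dot g (A k))                ≈⟨ *-congˡ (dot-comm z _) ⟩
      t * dot (λ k → dot g (A k)) z                ≈⟨ *-congˡ (Ringₚ.+-inverseʳ-unique ring _ _ sum≈0) ⟩
      t * - dot f z                                ≈⟨ Ringₚ.-‿distribʳ-* ring _ _ ⟨
      - (t * dot f z)                              ≈⟨ -‿cong tfz≈α ⟩
      - α                                          ∎))

-- The union of four spread elements.

module SpreadElements
  {q r : ℕ} (q-pp : IsPrimePower q) (1<r : 1 < r)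
  (F : CommutativeRing c ℓ) (F-field : IsFiniteField F q)
  (L : CommutativeRing c′ ℓ′) (L-field : IsFiniteField L (q ^ r))
  (ι : CommutativeRing.Carrier F → CommutativeRing.Carrier L)
  (ι-hom : IsRingHomomorphism (CommutativeRing.rawRing F) (CommutativeRing.rawRing L) ι)
  (γ : CommutativeRing.Carrier L) (γ-prim : IsPrimitive L γ)
  (μ : Vector (CommutativeRing.Carrier F) r) (μ-min : IsMinimalPolynomial F L ι γ μ)
  {i j : ℕ} (i<j : i < j) (no-repunit : ¬ (repunit q q-pp r ∣ j ∸ i))
  where

  open CommutativeRing F hiding (zero)
  open Field F F-field
  open DotProduct F
  open ProjectiveGeometry F F-field
  open Extension (ℕₚ.<⇒≤ 1<r) F F-field L L-field ι ι-hom γ γ-prim μ μ-min using (M; proportional⇒order)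
  open VecEq setoid using (_≋_)
  open SetoidReasoning setoid

  B : Pred (Point F (r ℕ.+ r)) _
  B = V₀ F r ∪ V F M i ∪ V F M j ∪ V∞ F r

  V-i⊎j : ℕ → Set
  V-i⊎j e = e ≡ i ⊎ e ≡ j

  V⊆B : ∀ {e} → V-i⊎j e → ∀ P → V F M e P → B P
  V⊆B (inj₁ ≡.refl) _ P∈V = inj₂ (inj₁ P∈V)
  V⊆B (inj₂ ≡.refl) _ P∈V = inj₂ (inj₂ (inj₁ P∈V))

  Witness : (f g : Vector Carrier r) → Carrier → Set _
  Witness f g α = ∃ λ e → V-i⊎j e × ∃ λ z → dot f z ≈ α × dot g (vecMul F z (matPow F M e)) ≈ - α

  witness : ∀ f g x y → dot f x + dot g y ≈ 0# → Witness f g (dot f x)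
  witness f g x y sum≈0 with dot f x ≟ 0#
  ... | yes α≈0 = i , inj₁ ≡.refl , 0ⱽ F , trans (dot-zeroʳ f (λ _ → refl)) (sym α≈0) , (begin
      dot g (vecMul F (0ⱽ F) (matPow F M i))  ≈⟨ dot-zeroʳ g (vecMul-0 (matPow F M i) (λ _ → refl)) ⟩
      0#                                      ≈⟨ Ringₚ.-0#≈0# ring ⟨
      - 0#                                    ≈⟨ -‿cong α≈0 ⟨
      - dot f x                               ∎)
  -- Since f(x) and g(y) = -f(x) are nonzero, neither functional is zero: the dichotomy uses this
  -- for `f`, the divisibility for `g`.
  ... | no α≉0 = hits (hitsGraph⊎proportional (matPow F M i) f g f≉0 (dot f x))
                      (hitsGraph⊎proportional (matPow F M j) f g f≉0 (dot f x))
    where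
    f≉0 : ¬ (f ≋ 0ⱽ F)
    f≉0 f≋0 = α≉0 (dot-zeroˡ x f≋0)
    g≉0 : ¬ (g ≋ 0ⱽ F)
    g≉0 g≋0 = α≉0 (trans (sym (+-identityʳ _)) (trans (+-congˡ (sym (dot-zeroˡ y g≋0))) sum≈0))
    Hit : ℕ → Set _
    Hit e = (∃ λ z → dot f z ≈ dot f x × dot g (vecMul F z (matPow F M e)) ≈ - dot f x) ⊎
            (∃ λ a → ∀ z → dot g (vecMul F z (matPow F M e)) ≈ a * dot f z)
    hits : Hit i → Hit j → Witness f g (dot f x)
    hits (inj₁ z)         _                = i , inj₁ ≡.refl , z
    hits (inj₂ _)         (inj₁ z)         = j , inj₂ ≡.refl , z
    hits (inj₂ (a , g-i)) (inj₂ (b , g-j)) = contradiction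
      (repunit-∣ q-pp r (j ∸ i) (proportional⇒order f g g≉0 (ℕₚ.<⇒≤ i<j) a b g-i g-j))
      no-repunit

  spanned : ∀ h v → dot h v ≈ 0# → SpannedBy (B ∩ (λ P → dot h (Point.vec P) ≈ 0#)) v
  spanned h v hv≈0 = build (witness f g x y fx+gy≈0)
    where
    f g x y : Vector Carrier r
    f k = h (k Fin.↑ˡ r)
    g k = h (r Fin.↑ʳ k)
    x k = v (k Fin.↑ˡ r)
    y k = v (r Fin.↑ʳ k)

    fx+gy≈0 : dot f x + dot g y ≈ 0#
    fx+gy≈0 = trans (sym (dot-++ {m = r} h v)) hv≈0

    B∩ker : Pred (Point F (r ℕ.+ r)) _
    B∩ker = B ∩ (λ P → dot h (Point.vec P) ≈ 0#)

    build : Witness f g (dot f x) → SpannedBy B∩ker v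
    build (e , e∈ij , z , fz≈α , gzMᵉ≈-α) = spannedBy-cong B∩ker (λ k → sym (decompose k))
      (spannedBy-+ B∩ker (x-z ++ 0ⱽ F {n = r}) (λ nz → inj₁ (V₀-intro x-z nz) , (begin
          dot h (x-z ++ 0ⱽ F {n = r})       ≈⟨ dot-h x-z (0ⱽ F) ⟩
          dot f x-z + dot g (0ⱽ F)          ≈⟨ +-cong (dot-minus f x z) (dot-zeroʳ g (λ _ → refl)) ⟩
          (dot f x - dot f z) + 0#          ≈⟨ +-identityʳ _ ⟩
          dot f x - dot f z                 ≈⟨ +-congˡ (-‿cong fz≈α) ⟩
          dot f x - dot f x                 ≈⟨ -‿inverseʳ _ ⟩
          0#                                ∎))
      (spannedBy-+ B∩ker (0ⱽ F {n = r} ++ y-zMᵉ) (λ nz → inj₂ (inj₂ (inj₂ (V∞-intro y-zMᵉ nz))) , (begin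
          dot h (0ⱽ F {n = r} ++ y-zMᵉ)     ≈⟨ dot-h (0ⱽ F) y-zMᵉ ⟩
          dot f (0ⱽ F) + dot g y-zMᵉ        ≈⟨ +-cong (dot-zeroʳ f (λ _ → refl)) (dot-minus g y zMᵉ) ⟩
          0# + (dot g y - dot g zMᵉ)        ≈⟨ +-identityˡ _ ⟩
          dot g y - dot g zMᵉ               ≈⟨ +-cong gy≈-α (-‿cong gzMᵉ≈-α) ⟩
          - dot f x - - dot f x             ≈⟨ -‿inverseʳ _ ⟩
          0#                                ∎))
      (spannedBy-+ B∩ker (z ++ zMᵉ) (λ nz → V⊆B e∈ij (record { vec = z ++ zMᵉ ; nonzero = nz }) (V-intro M e z nz) , (begin
          dot h (z ++ zMᵉ)                  ≈⟨ dot-h z zMᵉ ⟩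
          dot f z + dot g zMᵉ               ≈⟨ +-cong fz≈α gzMᵉ≈-α ⟩
          dot f x - dot f x                 ≈⟨ -‿inverseʳ _ ⟩
          0#                                ∎))
      (spannedBy-0 B∩ker))))
      where
      zMᵉ x-z y-zMᵉ : Vector Carrier r
      zMᵉ = vecMul F z (matPow F M e)
      x-z k = x k - z k
      y-zMᵉ k = y k - zMᵉ k

      gy≈-α : dot g y ≈ - dot f x
      gy≈-α = Ringₚ.+-inverseʳ-unique ring _ _ fx+gy≈0

      dot-h : ∀ u w → dot h (u ++ w) ≈ dot f u + dot g w
      dot-h u w = trans (dot-++ {m = r} h (u ++ w)) (+-cong
        (dot-congˡ f (λ k → reflexive (lookup-++ˡ u w k)))
        (dot-congˡ g (λ k → reflexive (lookup-++ʳ u w k))))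

      -- The trailing `0#` is the empty combination of `spannedBy-0`, onto which the three summands
      -- are stacked.
      decompose : v ≋ (λ k → (x-z ++ 0ⱽ F {n = r}) k + ((0ⱽ F {n = r} ++ y-zMᵉ) k + ((z ++ zMᵉ) k + 0#)))
      decompose k with splitAt r k in eq
      ... | inj₁ l = begin
        v k                            ≡⟨ ≡.cong v (Finₚ.splitAt⁻¹-↑ˡ eq) ⟨
        x l                            ≈⟨ Ringₚ.//-rightDividesˡ ring (z l) (x l) ⟨
        x-z l + z l                    ≈⟨ +-congˡ (trans (+-identityˡ _) (+-identityʳ _)) ⟨
        x-z l + (0# + (z l + 0#))      ∎
      ... | inj₂ l = begin
        v k                            ≡⟨ ≡.cong v (Finₚ.splitAt⁻¹-↑ʳ eq) ⟨
        y l                            ≈⟨ Ringₚ.//-rightDividesˡ ring (zMᵉ l) (y l) ⟨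
        y-zMᵉ l + zMᵉ l                ≈⟨ +-congˡ (+-identityʳ _) ⟨
        y-zMᵉ l + (zMᵉ l + 0#)         ≈⟨ +-identityˡ _ ⟨
        0# + (y-zMᵉ l + (zMᵉ l + 0#))  ∎

theorem4p1 : {c ℓ c′ ℓ′ : Level} (q r : ℕ) (q-pp : IsPrimePower q) → 2 ≤ r →
    (F : CommutativeRing c ℓ) → IsFiniteField F q →
    (L : CommutativeRing c′ ℓ′) → IsFiniteField L (q ^ r) →
    (ι : CommutativeRing.Carrier F → CommutativeRing.Carrier L) →
    IsRingHomomorphism (CommutativeRing.rawRing F) (CommutativeRing.rawRing L) ι →
    (γ : CommutativeRing.Carrier L) → IsPrimitive L γ →
    (μ : Vector (CommutativeRing.Carrier F) r) → IsMinimalPolynomial F L ι γ μ →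
    (i j : ℕ) → 0 < i → i < j → j < q ^ r →
    ((s : ℕ) → 1 < s → s ∣ r → ¬ (repunit q q-pp s ∣ j ∸ i)) →
    IsCuttingBlockingSet F
    (V₀ F r ∪ V F (companion F μ) i ∪ V F (companion F μ) j ∪ V∞ F r)
-- Matching `r` as a successor makes `r + r` reduce to a successor, as the criterion expects;
-- `2 ≤ r` excludes r = 0.
theorem4p1 q r@(suc _) q-pp 2≤r F F-field L L-field ι ι-hom γ γ-prim μ μ-min i j 0<i i<j j<q^r no-repunit =
  cuttingBlockingSet-criterion B spanned
  where
  open ProjectiveGeometry F F-field
  open SpreadElements q-pp 2≤r F F-field L L-field ι ι-hom γ γ-prim μ μ-min i<j (no-repunit r 2≤r ∣-refl)
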